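{- Let $\pi\colon\mathsf{States}\to\mathbb{R}_{\ge0}$ be a potential function. For every program $C$ of the heap-manipulating probabilistic guarded command language, $$\mathsf{ert}[\![C]\!](0)\;\preceq\;\mathsf{aert}_\pi[\![C]\!](0)+\pi .$$
   Context: States and programs. Fix a finite set $\mathrm{Vars}$ of variables; values are $\mathbb{N}$, locations are $\mathbb{N}_{>0}$. A stack is $s\colon \mathrm{Vars}\to\mathbb{N}$; a heap is a partial map $h$ from a finite set $\mathrm{dom}(h)\subseteq\mathbb{N}_{>0}$ to $\mathbb{N}$. $h_1\perp h_2$ means disjoint domains; then $h_1\star h_2$ is their union; $h_\emptyset$ is the empty heap. $\mathsf{States}$ is the set of pairs $(s,h)$. $s(e)$ is the value of a (heap-independent) arithmetic expression $e$ under $s$, $s\models\varphi$ means the Boolean expression $\varphi$ holds under $s$, $s[x\mapsto v]$ is the updated stack. Programs are generated by $C ::= \mathtt{tick}(e) \mid x:=e \mid x:=\mathtt{alloc}(e) \mid \langle e\rangle:=e' \mid x:=\langle e\rangle \mid \mathtt{free}(e) \mid \{C\}[p]\{C\} \mid \mathtt{if}(\varphi)\{C\}\mathtt{else}\{C\} \mid C;C \mid \mathtt{while}(\varphi)\{C\}$, where $p$ is an expression with $s(p)\in[0,1]\cap\mathbb{Q}$ for all $s$. The statements other than tick, probabilistic choice, conditional, sequencing and loops are called atomic. Runtimes. $\mathbb{T}$ is the set of functions $\mathsf{States}\to[0,\infty]$, ordered pointwise by $\preceq$; arithmetic is pointwise with $0\cdot\infty=0$; $0$ denotes the constant-zero function.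 $[\varphi]$ is the $0/1$-valued Iverson bracket. Truncated subtraction: $a\dot- b=\max(a-b,0)$, $\infty\dot- b=\infty$ for finite $b$, $a\dot-\infty=0$. $(f\oplus g)(s,h)=\min\{f(s,h_1)+g(s,h_2)\mid h=h_1\star h_2\}$; $(f \mathbin{ -\!\!\ominus} g)(s,h)=\sup\{g(s,h\star h')\dot- f(s,h')\mid h'\perp h\}$; $(\inf y\colon f)(s,h)=\inf_{v\in\mathbb{N}} f(s[y\mapsto v],h)$, $(\sup y\colon f)(s,h)=\sup_{v\in\mathbb{N}}f(s[y\mapsto v],h)$; $f[x/e](s,h)=f(s[x\mapsto s(e)],h)$. $\mathsf{tm}(e)(s,h)=s(e)$ if $h=h_\emptyset$, else $\infty$; $[e\mapsto e'](s,h)=0$ if $\mathrm{dom}(h)=\{s(e)\}$ and $h(s(e))=s(e')$, else $\infty$; $[e\mapsto -](s,h)=0$ if $\mathrm{dom}(h)=\{s(e)\}$, else $\infty$; $\bigoplus_{i=1}^{e} f_i$ is the separating sum over $i=1,\dots,s(e)$ (empty one: $[\mathsf{emp}]$, which is $0$ if $h=h_\emptyset$, else $\infty$). $\mathsf{ert}[\![C]\!]\colon\mathbb{T}\to\mathbb{T}$ (with $v$ fresh): $\mathsf{ert}[\![\mathtt{tick}(e)]\!](f)=\mathsf{tm}(e)\oplus f$; $\mathsf{ert}[\![x:=e]\!](f)=f[x/e]$; $\mathsf{ert}[\![x:=\mathtt{alloc}(e)]\!](f)=\sup v\colon (\bigoplus_{i=1}^{e}[v+i-1\mapsto 0])\mathbin{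 -\!\!\ominus} f[x/v]$; $\mathsf{ert}[\![\langle e\rangle:=e']\!](f)=[e\mapsto-]\oplus([e\mapsto e']\mathbin{ -\!\!\ominus} f)$; $\mathsf{ert}[\![x:=\langle e\rangle]\!](f)=\inf v\colon [e\mapsto v]\oplus([e\mapsto v]\mathbin{ -\!\!\ominus} f[x/v])$; $\mathsf{ert}[\![\mathtt{free}(e)]\!](f)=[e\mapsto-]\oplus f$; $\mathsf{ert}[\![C_1;C_2]\!](f)=\mathsf{ert}[\![C_1]\!](\mathsf{ert}[\![C_2]\!](f))$; conditional: $[\varphi]\cdot\mathsf{ert}[\![C_1]\!](f)+[\neg\varphi]\cdot\mathsf{ert}[\![C_2]\!](f)$; probabilistic choice: $p\cdot\mathsf{ert}[\![C_1]\!](f)+(1-p)\cdot\mathsf{ert}[\![C_2]\!](f)$; $\mathsf{ert}[\![\mathtt{while}(\varphi)\{C\}]\!](f)=\mathrm{lfp}\, g.\ [\neg\varphi]\cdot f+[\varphi]\cdot\mathsf{ert}[\![C]\!](g)$. Amortized runtimes. A potential function is $\pi\colon\mathsf{States}\to\mathbb{R}_{\ge0}$. $\mathbb{A}_\pi=\{X\colon\mathsf{States}\to\mathbb{R}\cup\{\infty\}\mid -\pi\le X\}$, ordered pointwise (complete lattice, least element $-\pi$). $\mathsf{aert}_\pi[\![C]\!]\colon\mathbb{A}_\pi\to\mathbb{A}_\pi$: $\mathsf{aert}_\pi[\![\mathtt{tick}(e)]\!](X)=e+X$; for atomic $C$ other than tick, $\mathsf{aert}_\pi[\![C]\!](X)=\mathsf{ert}[\![C]\!](X+\pi)-\pi$;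 sequencing by composition; conditional $[\varphi]\cdot\mathsf{aert}_\pi[\![C_1]\!](X)+[\neg\varphi]\cdot\mathsf{aert}_\pi[\![C_2]\!](X)$; probabilistic choice $p\cdot\mathsf{aert}_\pi[\![C_1]\!](X)+(1-p)\cdot\mathsf{aert}_\pi[\![C_2]\!](X)$; $\mathsf{aert}_\pi[\![\mathtt{while}(\varphi)\{C'\}]\!](X)=\mathrm{lfp}\,Y.\ [\neg\varphi]\cdot X+[\varphi]\cdot\mathsf{aert}_\pi[\![C']\!](Y)$ in $(\mathbb{A}_\pi,\preceq)$. -}

module Defs where

open import Algebra.Bundles using (CommutativeRing)
open import Algebra.Structures using (IsCommutativeRing)
import Algebra.Construct.NaturalChoice.Max as Max
import Algebra.Properties.Ring as RingProperties
open import Axiom.ExcludedMiddle using (ExcludedMiddle)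
open import Data.Bool.Base using (Bool; true; false; not; if_then_else_)
open import Data.Empty using (⊥-elim)
open import Data.Fin.Base using (Fin)
open import Data.Integer.Base as ℤ using (ℤ; -[1+_]) renaming (+_ to pos)
import Data.Integer.Properties as ℤ
open import Data.List.Base using (List; []; _++_)
open import Data.List.Membership.Propositional using (_∈_)
open import Data.List.Membership.Propositional.Properties using (∈-++⁺ˡ; ∈-++⁺ʳ)
open import Data.Maybe using (Maybe; just; nothing; _<∣>_; Is-just)
open import Data.Nat.Base as ℕ using (ℕ; zero; suc)
open import Data.Product.Base using (Σ-syntax; ∃; ∃-syntax; _×_; _,_; proj₁; proj₂)
open import Data.Rational.Base as ℚ using (ℚ; 0ℚ; 1ℚ)
open import Data.Sum.Base using (_⊎_; inj₁; inj₂)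
open import Data.Vec.Functional using (Vector; updateAt)
open import Function.Base using (const)
open import Function.Bundles using (_⇔_)
open import Level using (0ℓ)
open import Relation.Binary.Bundles using (TotalOrder)
open import Relation.Binary.Structures using (IsTotalOrder)
open import Relation.Binary.PropositionalEquality
  using (_≡_; _≢_; refl; sym; trans; cong; subst; subst₂)
open import Relation.Nullary.Decidable.Core using (yes; no; does)

------------------------------------------------------------------------
-- The real numbers

-- The library has no real numbers. They enter as a Dedekind-complete
-- ordered field, which determines ℝ up to unique isomorphism. The
-- inverse is total, with an unspecified value at 0.

record RealNumbers : Set₁ where
  infix  8 -_ _⁻¹
  infixl 7 _*_
  infixl 6 _+_
  infix  4 _≤_
  field
    ℝ                 : Set
    _+_ _*_           : ℝ → ℝ → ℝ
    -_ _⁻¹            : ℝ → ℝ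
    0# 1#             : ℝ
    _≤_               : ℝ → ℝ → Set
    isCommutativeRing : IsCommutativeRing _≡_ _+_ _*_ -_ 0# 1#
    0≢1               : 0# ≢ 1#
    *-inverseʳ        : ∀ x → x ≢ 0# → x * x ⁻¹ ≡ 1#
    isTotalOrder      : IsTotalOrder _≡_ _≤_
    +-monoʳ-≤         : ∀ z {x y} → x ≤ y → z + x ≤ z + y
    *-nonNeg          : ∀ {x y} → 0# ≤ x → 0# ≤ y → 0# ≤ x * y
    supremum          : (P : ℝ → Set) → ∃ P → (∃[ u ] (∀ x → P x → x ≤ u)) →
                        ∃[ s ] (∀ x → P x → x ≤ s) ×
                               (∀ u → (∀ x → P x → x ≤ u) → s ≤ u)

  commutativeRing : CommutativeRing 0ℓ 0ℓ
  commutativeRing = record { isCommutativeRing = isCommutativeRing }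

  totalOrder : TotalOrder 0ℓ 0ℓ 0ℓ
  totalOrder = record { isTotalOrder = isTotalOrder }

  open CommutativeRing commutativeRing public
    using ( _-_; +-comm; +-assoc; +-identityˡ; +-identityʳ; -‿inverseʳ; -‿inverseˡ
          ; *-comm; *-identityˡ; distribˡ; distribʳ; zeroˡ; zeroʳ; ring )
  open TotalOrder totalOrder public
    using (total; antisym) renaming (refl to ≤-refl; trans to ≤-trans; reflexive to ≤-reflexive)
  open Max totalOrder public using (_⊔_; x≤x⊔y; x≤y⊔x)
  open RingProperties ring public using (-‿distribˡ-*; -‿distribʳ-*; -‿involutive)

  +-monoˡ-≤ : ∀ z {x y} → x ≤ y → x + z ≤ y + z
  +-monoˡ-≤ z {x} {y} p = subst₂ _≤_ (+-comm z x) (+-comm z y) (+-monoʳ-≤ z p)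

  +-mono-≤ : ∀ {x y u v} → x ≤ y → u ≤ v → x + u ≤ y + v
  +-mono-≤ {x} {y} {u} {v} p q = ≤-trans (+-monoˡ-≤ u p) (+-monoʳ-≤ y q)

  x≤y⇒0≤y-x : ∀ {x y} → x ≤ y → 0# ≤ y - x
  x≤y⇒0≤y-x {x} {y} p = subst (_≤ y - x) (-‿inverseʳ x) (+-monoˡ-≤ (- x) p)

  y-x+x≡y : ∀ x y → (y - x) + x ≡ y
  y-x+x≡y x y =
    trans (+-assoc y (- x) x) (trans (cong (y +_) (-‿inverseˡ x)) (+-identityʳ y))

  0≤y-x⇒x≤y : ∀ {x y} → 0# ≤ y - x → x ≤ y
  0≤y-x⇒x≤y {x} {y} p = subst₂ _≤_ (+-identityˡ x) (y-x+x≡y x y) (+-monoˡ-≤ x p)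

  *-monoʳ-≤ : ∀ {c x y} → 0# ≤ c → x ≤ y → c * x ≤ c * y
  *-monoʳ-≤ {c} {x} {y} 0≤c p = 0≤y-x⇒x≤y (subst (0# ≤_)
    (trans (distribˡ c y (- x)) (cong (c * y +_) (sym (-‿distribʳ-* c x))))
    (*-nonNeg 0≤c (x≤y⇒0≤y-x p)))

  x≤0⇒0≤-x : ∀ {x} → x ≤ 0# → 0# ≤ - x
  x≤0⇒0≤-x {x} p = subst (0# ≤_) (+-identityˡ (- x)) (x≤y⇒0≤y-x p)

  0≤x⇒-x≤0 : ∀ {x} → 0# ≤ x → - x ≤ 0#
  0≤x⇒-x≤0 {x} p = 0≤y-x⇒x≤y (subst (0# ≤_)
    (sym (trans (+-identityˡ (- - x)) (-‿involutive x))) p)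

  0≤1 : 0# ≤ 1#
  0≤1 with total 0# 1#
  ... | inj₁ p = p
  ... | inj₂ p = subst (0# ≤_)
    (trans (sym (-‿distribˡ-* 1# (- 1#)))
      (trans (cong -_ (*-identityˡ (- 1#))) (-‿involutive 1#)))
    (*-nonNeg (x≤0⇒0≤-x p) (x≤0⇒0≤-x p))

  ⁻¹-nonNeg : ∀ {x} → 0# ≤ x → x ≢ 0# → 0# ≤ x ⁻¹
  ⁻¹-nonNeg {x} 0≤x x≢0 with total 0# (x ⁻¹)
  ... | inj₁ p = p
  ... | inj₂ p = ⊥-elim (0≢1 (antisym 0≤1
    (subst₂ _≤_ (*-inverseʳ x x≢0) (zeroʳ x) (*-monoʳ-≤ 0≤x p))))

  fromℕ : ℕ → ℝ
  fromℕ zero    = 0#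
  fromℕ (suc k) = 1# + fromℕ k

  fromℤ : ℤ → ℝ
  fromℤ (pos k)  = fromℕ k
  fromℤ -[1+ k ] = - fromℕ (suc k)

  fromℚ : ℚ → ℝ
  fromℚ q = fromℤ (ℚ.numerator q) * fromℕ (ℚ.denominatorℕ q) ⁻¹

  fromℕ-nonNeg : ∀ k → 0# ≤ fromℕ k
  fromℕ-nonNeg zero    = ≤-refl
  fromℕ-nonNeg (suc k) =
    subst (_≤ 1# + fromℕ k) (+-identityˡ 0#) (+-mono-≤ 0≤1 (fromℕ-nonNeg k))

  fromℕ-mono-≤ : ∀ {j k} → j ℕ.≤ k → fromℕ j ≤ fromℕ k
  fromℕ-mono-≤ {k = k} ℕ.z≤n = fromℕ-nonNeg k
  fromℕ-mono-≤ (ℕ.s≤s p)     = +-monoʳ-≤ 1# (fromℕ-mono-≤ p)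

  fromℕ-suc≢0 : ∀ k → fromℕ (suc k) ≢ 0#
  fromℕ-suc≢0 k eq = 0≢1 (antisym 0≤1
    (subst₂ _≤_ (+-identityʳ 1#) eq (+-monoʳ-≤ 1# (fromℕ-nonNeg k))))

  fromℚ-nonNeg : ∀ {q} → 0ℚ ℚ.≤ q → 0# ≤ fromℚ q
  fromℚ-nonNeg {ℚ.mkℚ (pos k) d _} _ =
    *-nonNeg (fromℕ-nonNeg k) (⁻¹-nonNeg (fromℕ-nonNeg (suc d)) (fromℕ-suc≢0 d))
  fromℚ-nonNeg {ℚ.mkℚ -[1+ k ] d _} (ℚ.*≤* ())

  fromℚ-≤1 : ∀ {q} → 0ℚ ℚ.≤ q → q ℚ.≤ 1ℚ → fromℚ q ≤ 1#
  fromℚ-≤1 {ℚ.mkℚ (pos k) d _} _ (ℚ.*≤* p) =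
    subst₂ _≤_ (*-comm inv (fromℕ k))
      (trans (*-comm inv (fromℕ (suc d))) (*-inverseʳ _ (fromℕ-suc≢0 d)))
      (*-monoʳ-≤ (⁻¹-nonNeg (fromℕ-nonNeg (suc d)) (fromℕ-suc≢0 d))
        (fromℕ-mono-≤ (ℤ.drop‿+≤+
          (subst₂ ℤ._≤_ (ℤ.*-identityʳ (pos k)) (ℤ.*-identityˡ (pos (suc d))) p))))
    where inv = fromℕ (suc d) ⁻¹
  fromℚ-≤1 {ℚ.mkℚ -[1+ k ] d _} (ℚ.*≤* ())

------------------------------------------------------------------------
-- States

-- The finite set of variables is Fin n.
Stack : ℕ → Set
Stack n = Vector ℕ n

infixl 9 _[_↦_]
_[_↦_] : ∀ {n} → Stack n → Fin n → ℕ → Stack n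
s [ x ↦ v ] = updateAt s x (const v)

-- Finite partial maps from positive naturals to naturals. The side
-- conditions are irrelevant, so a heap is determined by `lookup`.
record Heap : Set where
  constructor heap
  field
    lookup  : ℕ → Maybe ℕ
    .null   : lookup 0 ≡ nothing
    .finite : Σ[ ls ∈ List ℕ ] (∀ l v → lookup l ≡ just v → l ∈ ls)
open Heap public using (lookup)

_∈dom_ : ℕ → Heap → Set
l ∈dom h = Is-just (lookup h l)

_⊥_ : Heap → Heap → Set
h₁ ⊥ h₂ = ∀ l → lookup h₁ l ≡ nothing ⊎ lookup h₂ l ≡ nothing

h∅ : Heap
h∅ = record { lookup = λ _ → nothing ; null = refl ; finite = [] , λ _ _ () }

<∣>-null : ∀ {a b : Maybe ℕ} → a ≡ nothing → b ≡ nothing → (a <∣> b) ≡ nothing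
<∣>-null refl refl = refl

<∣>-finite : (m₁ m₂ : ℕ → Maybe ℕ) →
             (Σ[ ls ∈ List ℕ ] (∀ l v → m₁ l ≡ just v → l ∈ ls)) →
             (Σ[ ls ∈ List ℕ ] (∀ l v → m₂ l ≡ just v → l ∈ ls)) →
             Σ[ ls ∈ List ℕ ] (∀ l v → (m₁ l <∣> m₂ l) ≡ just v → l ∈ ls)
<∣>-finite m₁ m₂ (ls₁ , p₁) (ls₂ , p₂) = ls₁ ++ ls₂ , λ l v → go l v (m₁ l) refl
  where
  go : ∀ l v a → m₁ l ≡ a → (a <∣> m₂ l) ≡ just v → l ∈ (ls₁ ++ ls₂)
  go l v (just w) e _ = ∈-++⁺ˡ (p₁ l w e)
  go l v nothing  _ q = ∈-++⁺ʳ ls₁ (p₂ l v q)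

-- Total, left-biased union; only used on heaps with h₁ ⊥ h₂.
infixr 6 _⋆_
_⋆_ : Heap → Heap → Heap
heap m₁ null₁ fin₁ ⋆ heap m₂ null₂ fin₂ = record
  { lookup = λ l → m₁ l <∣> m₂ l
  ; null   = <∣>-null null₁ null₂
  ; finite = <∣>-finite m₁ m₂ fin₁ fin₂
  }

State : ℕ → Set
State n = Stack n × Heap

------------------------------------------------------------------------
-- Programs

-- Heap-independent expressions are represented by their denotations.

AExpr BExpr : ℕ → Set
AExpr n = Stack n → ℕ
BExpr n = Stack n → Bool

record ProbExpr (n : ℕ) : Set where
  field
    prob   : Stack n → ℚ
    nonNeg : ∀ s → 0ℚ ℚ.≤ prob s
    ≤1     : ∀ s → prob s ℚ.≤ 1ℚ

infixr 5 _⨟_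
infix  6 _≔_ _≔alloc_ ⟨_⟩≔_ _≔⟨_⟩

data Program (n : ℕ) : Set where
  tick     : (e : AExpr n) → Program n
  _≔_      : (x : Fin n) (e : AExpr n) → Program n
  _≔alloc_ : (x : Fin n) (e : AExpr n) → Program n
  ⟨_⟩≔_    : (e e′ : AExpr n) → Program n
  _≔⟨_⟩    : (x : Fin n) (e : AExpr n) → Program n
  free     : (e : AExpr n) → Program n
  choice   : (C₁ : Program n) (p : ProbExpr n) (C₂ : Program n) → Program n
  ite      : (φ : BExpr n) (C₁ C₂ : Program n) → Program n
  _⨟_      : (C₁ C₂ : Program n) → Program n
  while    : (φ : BExpr n) (C : Program n) → Program n

------------------------------------------------------------------------
-- Runtimes and amortized runtimes

-- Excluded middle is what makes arbitrary infima exist and predicates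
-- on states usable in case distinctions.

module Semantics (em : ExcludedMiddle 0ℓ) (R : RealNumbers) (n : ℕ) where
  open RealNumbers R

  -- ℝ ∪ {∞}
  data ℝ∞ : Set where
    fin : ℝ → ℝ∞
    ∞   : ℝ∞

  infix 4 _≤∞_
  data _≤∞_ : ℝ∞ → ℝ∞ → Set where
    fin≤ : ∀ {x y} → x ≤ y → fin x ≤∞ fin y
    ≤-top : ∀ {x} → x ≤∞ ∞

  ≤∞-trans : ∀ {x y z} → x ≤∞ y → y ≤∞ z → x ≤∞ z
  ≤∞-trans (fin≤ p) (fin≤ q) = fin≤ (≤-trans p q)
  ≤∞-trans _        ≤-top    = ≤-top

  infixl 6 _+∞_
  _+∞_ : ℝ∞ → ℝ∞ → ℝ∞
  fin x +∞ fin y = fin (x + y)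
  fin x +∞ ∞     = ∞
  ∞     +∞ y     = ∞

  -- Multiplication by a nonnegative real, with 0 · ∞ = 0.
  infixl 7 _·∞_
  _·∞_ : ℝ → ℝ∞ → ℝ∞
  c ·∞ fin x = fin (c * x)
  c ·∞ ∞     = if does (em {c ≡ 0#}) then fin 0# else ∞

  infixl 6 _-∞_
  _-∞_ : ℝ∞ → ℝ → ℝ∞
  fin x -∞ r = fin (x - r)
  ∞     -∞ r = ∞

  infixl 6 _∸∞_
  _∸∞_ : ℝ∞ → ℝ∞ → ℝ∞
  fin x ∸∞ fin y = fin ((x - y) ⊔ 0#)
  ∞     ∸∞ fin y = ∞
  x     ∸∞ ∞     = fin 0#

  -- The complete lattice {x ∈ ℝ ∪ {∞} ∣ b ≤ x}.
  record [_,∞] (b : ℝ) : Set where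
    constructor _,_
    field
      val   : ℝ∞
      b≤val : fin b ≤∞ val
  open [_,∞] public

  top : ∀ {b} → [ b ,∞]
  top = ∞ , ≤-top

  infimum : ∀ {b} {I : Set} (f : I → [ b ,∞]) →
            Σ[ m ∈ [ b ,∞] ] (∀ i → val m ≤∞ val (f i)) ×
                             (∀ (u : [ b ,∞]) → (∀ i → val u ≤∞ val (f i)) → val u ≤∞ val m)
  infimum {b} {I} f with em {∃[ i ] ∃[ r ] val (f i) ≡ fin r}
  ... | no ¬fin = top , (λ i → allInf i (val (f i)) refl) , λ _ _ → ≤-top
    where
    allInf : ∀ i v → val (f i) ≡ v → ∞ ≤∞ v
    allInf i (fin r) e = ⊥-elim (¬fin (i , r , e))
    allInf i ∞       _ = ≤-top
  ... | yes (i₀ , r₀ , e₀) = (fin s , fin≤ (s-ub b λ i → b≤val (f i))) , lower , greatest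
    where
    Lower : ℝ → Set
    Lower r = ∀ i → fin r ≤∞ val (f i)

    lower≤ : ∀ {i r} → val (f i) ≡ fin r → ∀ x → Lower x → x ≤ r
    lower≤ {i} e x p with subst (fin x ≤∞_) e (p i)
    ... | fin≤ q = q

    sup = supremum Lower (b , λ i → b≤val (f i)) (r₀ , lower≤ e₀)
    s = proj₁ sup
    s-ub = proj₁ (proj₂ sup)
    s-least = proj₂ (proj₂ sup)

    lower′ : ∀ i v → val (f i) ≡ v → fin s ≤∞ v
    lower′ i (fin r) e = fin≤ (s-least r (lower≤ e))
    lower′ i ∞       _ = ≤-top

    lower : ∀ i → fin s ≤∞ val (f i)
    lower i = lower′ i (val (f i)) refl

    greatest : ∀ (u : [ b ,∞]) → (∀ i → val u ≤∞ val (f i)) → val u ≤∞ fin s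
    greatest (fin u , _) p = fin≤ (s-ub u p)
    greatest (∞     , _) p with subst (∞ ≤∞_) e₀ (p i₀)
    ... | ()

  ⨅ : ∀ {b} {I : Set} → (I → [ b ,∞]) → [ b ,∞]
  ⨅ f = proj₁ (infimum f)

  -- The supremum is the least upper bound, i.e. the infimum of all upper bounds.
  ⨆ : ∀ {b} {I : Set} → (I → [ b ,∞]) → [ b ,∞]
  ⨆ {b} {I} f = ⨅ {I = Σ[ u ∈ [ b ,∞] ] (∀ i → val (f i) ≤∞ val u)} proj₁

  ⨆-upper : ∀ {b} {I : Set} (f : I → [ b ,∞]) → ∀ i → val (f i) ≤∞ val (⨆ f)
  ⨆-upper f i = proj₂ (proj₂ (infimum _)) (f i) λ (_ , ub) → ub i

  ⨆-least : ∀ {b} {I : Set} (f : I → [ b ,∞]) (u : [ b ,∞]) →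
            (∀ i → val (f i) ≤∞ val u) → val (⨆ f) ≤∞ val u
  ⨆-least f u ub = proj₁ (proj₂ (infimum _)) (u , ub)

  ·∞-lower : ∀ {b c x} → 0# ≤ c → fin b ≤∞ x → fin (c * b) ≤∞ c ·∞ x
  ·∞-lower 0≤c (fin≤ p) = fin≤ (*-monoʳ-≤ 0≤c p)
  ·∞-lower {b} {c} 0≤c ≤-top with em {c ≡ 0#}
  ... | yes refl = fin≤ (≤-reflexive (zeroˡ b))
  ... | no  _    = ≤-top

  +∞-mono : ∀ {a b x y} → fin a ≤∞ x → fin b ≤∞ y → fin (a + b) ≤∞ x +∞ y
  +∞-mono (fin≤ p) (fin≤ q) = fin≤ (+-mono-≤ p q)
  +∞-mono (fin≤ p) ≤-top       = ≤-top
  +∞-mono ≤-top       _        = ≤-top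

  -- The common shape of [φ] · f + [¬φ] · g and p · f + (1 - p) · g.
  record Weights : Set where
    field
      c d   : ℝ
      0≤c   : 0# ≤ c
      0≤d   : 0# ≤ d
      c+d≡1 : c + d ≡ 1#

  mix : ∀ {b} → Weights → [ b ,∞] → [ b ,∞] → [ b ,∞]
  mix {b} w (x , p) (y , q) =
    (c ·∞ x +∞ d ·∞ y) ,
    subst (λ t → fin t ≤∞ (c ·∞ x +∞ d ·∞ y))
      (trans (sym (distribʳ b c d)) (trans (cong (_* b) c+d≡1) (*-identityˡ b)))
      (+∞-mono (·∞-lower 0≤c p) (·∞-lower 0≤d q))
    where open Weights w

  iverson : Bool → ℝ
  iverson true  = 1#
  iverson false = 0#

  -- [φ] and [¬φ]
  guardWeights : BExpr n → Stack n → Weights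
  guardWeights φ s = record
    { c = iverson (φ s) ; d = iverson (not (φ s))
    ; 0≤c = nonNeg (φ s) ; 0≤d = nonNeg (not (φ s)) ; c+d≡1 = sum (φ s) }
    where
    nonNeg : ∀ b → 0# ≤ iverson b
    nonNeg true  = 0≤1
    nonNeg false = ≤-refl
    sum : ∀ b → iverson b + iverson (not b) ≡ 1#
    sum true  = +-identityʳ 1#
    sum false = +-identityˡ 1#

  -- p and 1 - p
  probWeights : ProbExpr n → Stack n → Weights
  probWeights p s = record
    { c = fromℚ (prob s) ; d = 1# - fromℚ (prob s)
    ; 0≤c = fromℚ-nonNeg (nonNeg s) ; 0≤d = x≤y⇒0≤y-x (fromℚ-≤1 (nonNeg s) (≤1 s))
    ; c+d≡1 = trans (+-comm _ _) (y-x+x≡y (fromℚ (prob s)) 1#) }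
    where open ProbExpr p

  -- Functions X : States → ℝ ∪ {∞} with b ≤ X, ordered pointwise.
  Above : (State n → ℝ) → Set
  Above b = (σ : State n) → [ b σ ,∞]

  infix 4 _⪯_
  _⪯_ : ∀ {b} → Above b → Above b → Set
  f ⪯ g = ∀ σ → val (f σ) ≤∞ val (g σ)

  -- Knaster–Tarski: the least fixed point of a monotone Φ is the
  -- pointwise infimum of its prefixed points.
  lfp : ∀ {b} → (Above b → Above b) → Above b
  lfp {b} Φ σ = ⨅ {I = Σ[ g ∈ Above b ] (Φ g ⪯ g)} λ (g , _) → g σ

  lfp-least : ∀ {b} (Φ : Above b → Above b) {g} → Φ g ⪯ g → lfp Φ ⪯ g
  lfp-least Φ {g} p σ = proj₁ (proj₂ (infimum _)) (g , p)

  Monotone : ∀ {b} → (Above b → Above b) → Set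
  Monotone Φ = ∀ {f g} → f ⪯ g → Φ f ⪯ Φ g

  lfp-fixed : ∀ {b} (Φ : Above b → Above b) → Monotone Φ →
              (Φ (lfp Φ) ⪯ lfp Φ) × (lfp Φ ⪯ Φ (lfp Φ))
  lfp-fixed Φ mono = prefixed , lfp-least Φ {Φ (lfp Φ)} (mono {Φ (lfp Φ)} {lfp Φ} prefixed)
    where
    prefixed : Φ (lfp Φ) ⪯ lfp Φ
    prefixed σ = proj₂ (proj₂ (infimum _)) (Φ (lfp Φ) σ)
      λ (g , p) → ≤∞-trans (mono {lfp Φ} {g} (lfp-least Φ {g} p) σ) (p σ)

  mixGuard : ∀ {b} → BExpr n → Above b → Above b → Above b
  mixGuard φ f g (s , h) = mix (guardWeights φ s) (f (s , h)) (g (s , h))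

  mixProb : ∀ {b} → ProbExpr n → Above b → Above b → Above b
  mixProb p f g (s , h) = mix (probWeights p s) (f (s , h)) (g (s , h))

  𝕋 : Set
  𝕋 = Above (const 0#)

  𝟎 : 𝕋
  𝟎 _ = fin 0# , fin≤ ≤-refl

  fromℕ∞ : ℕ → [ 0# ,∞]
  fromℕ∞ k = fin (fromℕ k) , fin≤ (fromℕ-nonNeg k)

  _when_ : [ 0# ,∞] → Set → [ 0# ,∞]
  x when P = if does (em {P}) then x else top

  infixl 6 _+⁺_ _∸⁺_
  _+⁺_ : [ 0# ,∞] → [ 0# ,∞] → [ 0# ,∞]
  (x , p) +⁺ (y , q) =
    (x +∞ y) , subst (λ t → fin t ≤∞ (x +∞ y)) (+-identityˡ 0#) (+∞-mono p q)

  ∸∞-nonNeg : ∀ x y → fin 0# ≤∞ x ∸∞ y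
  ∸∞-nonNeg (fin x) (fin y) = fin≤ (x≤y⊔x (x - y) 0#)
  ∸∞-nonNeg ∞       (fin y) = ≤-top
  ∸∞-nonNeg (fin x) ∞       = fin≤ ≤-refl
  ∸∞-nonNeg ∞       ∞       = fin≤ ≤-refl

  _∸⁺_ : [ 0# ,∞] → [ 0# ,∞] → [ 0# ,∞]
  (x , _) ∸⁺ (y , _) = (x ∸∞ y) , ∸∞-nonNeg x y

  -- A heap has finitely many splittings, and at least one, so the
  -- infimum is a minimum.
  infixr 6 _⊕_
  _⊕_ : 𝕋 → 𝕋 → 𝕋
  (f ⊕ g) (s , h) =
    ⨅ {I = Σ[ h₁ ∈ Heap ] Σ[ h₂ ∈ Heap ] (h₁ ⊥ h₂ × h ≡ h₁ ⋆ h₂)}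
      λ (h₁ , h₂ , _) → f (s , h₁) +⁺ g (s , h₂)

  infixr 5 _-⊖_
  _-⊖_ : 𝕋 → 𝕋 → 𝕋
  (f -⊖ g) (s , h) =
    ⨆ {I = Σ[ h′ ∈ Heap ] h′ ⊥ h} λ (h′ , _) → g (s , h ⋆ h′) ∸⁺ f (s , h′)

  -- Quantifiers over a fresh variable v bind a natural number instead:
  -- freshness means nothing else depends on the value of v in the stack.
  ⨅ℕ ⨆ℕ : (ℕ → 𝕋) → 𝕋
  ⨅ℕ F σ = ⨅ λ v → F v σ
  ⨆ℕ F σ = ⨆ λ v → F v σ

  _[_/_] : 𝕋 → Fin n → AExpr n → 𝕋
  (f [ x / e ]) (s , h) = f (s [ x ↦ e s ] , h)

  tm : AExpr n → 𝕋
  tm e (s , h) = fromℕ∞ (e s) when (h ≡ h∅)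

  emp : 𝕋
  emp (s , h) = fromℕ∞ 0 when (h ≡ h∅)

  [_↦_]ₚ : AExpr n → AExpr n → 𝕋
  [ e ↦ e′ ]ₚ (s , h) =
    fromℕ∞ 0 when ((∀ l → l ∈dom h ⇔ l ≡ e s) × lookup h (e s) ≡ just (e′ s))

  [_↦-]ₚ : AExpr n → 𝕋
  [ e ↦-]ₚ (s , h) = fromℕ∞ 0 when (∀ l → l ∈dom h ⇔ l ≡ e s)

  -- ⨁≤ k f is the separating sum of f 1 , … , f k.
  ⨁≤ : ℕ → (ℕ → 𝕋) → 𝕋
  ⨁≤ zero    f = emp
  ⨁≤ (suc k) f = ⨁≤ k f ⊕ f (suc k)

  ⨁ : AExpr n → (ℕ → 𝕋) → 𝕋
  ⨁ e f (s , h) = ⨁≤ (e s) f (s , h)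

  ert : Program n → 𝕋 → 𝕋
  ert (tick e)         f = tm e ⊕ f
  ert (x ≔ e)          f = f [ x / e ]
  ert (x ≔alloc e)     f =
    ⨆ℕ λ v → (⨁ e λ i → [ const (v ℕ.+ i ℕ.∸ 1) ↦ const 0 ]ₚ) -⊖ f [ x / const v ]
  ert (⟨ e ⟩≔ e′)      f = [ e ↦-]ₚ ⊕ ([ e ↦ e′ ]ₚ -⊖ f)
  ert (x ≔⟨ e ⟩)       f =
    ⨅ℕ λ v → [ e ↦ const v ]ₚ ⊕ ([ e ↦ const v ]ₚ -⊖ f [ x / const v ])
  ert (free e)         f = [ e ↦-]ₚ ⊕ f
  ert (choice C₁ p C₂) f = mixProb p (ert C₁ f) (ert C₂ f)
  ert (ite φ C₁ C₂)    f = mixGuard φ (ert C₁ f) (ert C₂ f)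
  ert (C₁ ⨟ C₂)        f = ert C₁ (ert C₂ f)
  ert (while φ C)      f = lfp λ g → mixGuard φ (ert C g) f

  record Potential : Set where
    constructor _,_
    field
      pot     : State n → ℝ
      pot-pos : ∀ σ → 0# ≤ pot σ
  open Potential public

  𝔸 : Potential → Set
  𝔸 π = Above (λ σ → - pot π σ)

  𝟎ᴬ : (π : Potential) → 𝔸 π
  𝟎ᴬ π σ = fin 0# , fin≤ (0≤x⇒-x≤0 (pot-pos π σ))

  -- X + π
  add-potential : (π : Potential) → 𝔸 π → 𝕋
  add-potential π X σ =
    (val (X σ) +∞ fin (pot π σ)) ,
    subst (λ t → fin t ≤∞ (val (X σ) +∞ fin (pot π σ))) (-‿inverseˡ (pot π σ))
      (+∞-mono (b≤val (X σ)) (fin≤ ≤-refl))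

  -- f - π
  sub-potential : (π : Potential) → 𝕋 → 𝔸 π
  sub-potential π f σ = (val (f σ) -∞ pot π σ) , bound (b≤val (f σ))
    where
    bound : ∀ {y} → fin 0# ≤∞ y → fin (- pot π σ) ≤∞ y -∞ pot π σ
    bound {fin y} (fin≤ q) =
      fin≤ (subst (_≤ y - pot π σ) (+-identityˡ (- pot π σ)) (+-monoˡ-≤ (- pot π σ) q))
    bound {∞} _ = ≤-top

  syntax add-potential π X = X +[ π ]
  syntax sub-potential π f = f -[ π ]

  -- e + X
  add-cost : (π : Potential) → AExpr n → 𝔸 π → 𝔸 π
  add-cost π e X σ@(s , _) =
    (fin (fromℕ (e s)) +∞ val (X σ)) ,
    subst (λ t → fin t ≤∞ (fin (fromℕ (e s)) +∞ val (X σ))) (+-identityˡ (- pot π σ))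
      (+∞-mono (fin≤ (fromℕ-nonNeg (e s))) (b≤val (X σ)))

  aert : (π : Potential) → Program n → 𝔸 π → 𝔸 π
  aert π (tick e)         X = add-cost π e X
  aert π C@(x ≔ e)        X = ert C (X +[ π ]) -[ π ]
  aert π C@(x ≔alloc e)   X = ert C (X +[ π ]) -[ π ]
  aert π C@(⟨ e ⟩≔ e′)    X = ert C (X +[ π ]) -[ π ]
  aert π C@(x ≔⟨ e ⟩)     X = ert C (X +[ π ]) -[ π ]
  aert π C@(free e)       X = ert C (X +[ π ]) -[ π ]
  aert π (choice C₁ p C₂) X = mixProb p (aert π C₁ X) (aert π C₂ X)
  aert π (ite φ C₁ C₂)    X = mixGuard φ (aert π C₁ X) (aert π C₂ X)
  aert π (C₁ ⨟ C₂)        X = aert π C₁ (aert π C₂ X)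
  aert π (while φ C)      X = lfp λ Y → mixGuard φ (aert π C Y) X

{-# OPTIONS --safe #-}

-- For monotone ert, the bound ert C (X + π) ⪯ aert C X + π holds for every
-- X by induction on C; the theorem follows from 0 ⪯ 0 + π. For tick the
-- splitting h = h∅ ⋆ h pays the cost; for mixtures the weights of π add up
-- to 1; and for loops Y + π is a prefixed point of the ert functional
-- whenever Y is one of the aert functional.

module Submission where

open import Defs
open import Axiom.ExcludedMiddle using (ExcludedMiddle)
import Algebra.Construct.NaturalChoice.MaxOp as MaxOp
import Algebra.Construct.NaturalChoice.Max as Max
import Algebra.Properties.CommutativeSemigroup as CommutativeSemigroupProperties
open import Algebra.Bundles using (CommutativeRing)
open import Data.Empty using (⊥-elim)
open import Data.Nat.Base as ℕ using (ℕ)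
open import Data.Product.Base using (_,_; proj₁; proj₂)
open import Data.Sum.Base using (inj₁)
open import Function.Base using (const)
open import Level using (0ℓ)
open import Relation.Binary.PropositionalEquality
  using (_≡_; refl; sym; trans; cong; subst)
open import Relation.Nullary.Decidable.Core using (yes; no)

module _ (em : ExcludedMiddle 0ℓ) (R : RealNumbers) (n : ℕ) where
  open RealNumbers R
  open Semantics em R n
  open MaxOp (Max.maxOperator totalOrder) using (⊔-monoˡ-≤)
  open CommutativeSemigroupProperties
    (CommutativeRing.+-commutativeSemigroup commutativeRing) using (interchange)

  -- Order and arithmetic in the extended reals

  ≤∞-refl : ∀ {x} → x ≤∞ x
  ≤∞-refl {fin x} = fin≤ ≤-refl
  ≤∞-refl {∞}     = ≤-top

  ≤∞-reflexive : ∀ {x y} → x ≡ y → x ≤∞ y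
  ≤∞-reflexive refl = ≤∞-refl

  +∞-mono-≤ : ∀ {x y u v} → x ≤∞ y → u ≤∞ v → x +∞ u ≤∞ y +∞ v
  +∞-mono-≤ (fin≤ p) (fin≤ q) = fin≤ (+-mono-≤ p q)
  +∞-mono-≤ (fin≤ _) ≤-top    = ≤-top
  +∞-mono-≤ ≤-top    _        = ≤-top

  +∞-assoc : ∀ x y z → (x +∞ y) +∞ z ≡ x +∞ (y +∞ z)
  +∞-assoc (fin x) (fin y) (fin z) = cong fin (+-assoc x y z)
  +∞-assoc (fin x) (fin y) ∞       = refl
  +∞-assoc (fin x) ∞       _       = refl
  +∞-assoc ∞       _       _       = refl

  +∞-interchange-fin : ∀ x y a b →
    (x +∞ fin a) +∞ (y +∞ fin b) ≡ (x +∞ y) +∞ fin (a + b)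
  +∞-interchange-fin (fin x) (fin y) a b = cong fin (interchange x a y b)
  +∞-interchange-fin (fin x) ∞       a b = refl
  +∞-interchange-fin ∞       _       a b = refl

  ≤∞-sub-add : ∀ x r → x ≤∞ (x -∞ r) +∞ fin r
  ≤∞-sub-add (fin x) r = fin≤ (≤-reflexive (sym (y-x+x≡y r x)))
  ≤∞-sub-add ∞       r = ≤-top

  -- Half of the adjunction between adding and subtracting a finite `r`; it moves a potential to the
  -- other side of an inequality.
  ≤∞-add⇒sub-≤∞ : ∀ {x y r} → x ≤∞ y +∞ fin r → x -∞ r ≤∞ y
  ≤∞-add⇒sub-≤∞ {fin x} {fin y} {r} (fin≤ p) = fin≤
    (subst (x - r ≤_)
      (trans (+-assoc y r (- r)) (trans (cong (y +_) (-‿inverseʳ r)) (+-identityʳ y)))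
      (+-monoˡ-≤ (- r) p))
  ≤∞-add⇒sub-≤∞ {y = ∞} _ = ≤-top

  ∸∞-monoˡ-≤ : ∀ z {x y} → x ≤∞ y → x ∸∞ z ≤∞ y ∸∞ z
  ∸∞-monoˡ-≤ (fin z) (fin≤ p)          = fin≤ (⊔-monoˡ-≤ 0# (+-monoˡ-≤ (- z) p))
  ∸∞-monoˡ-≤ (fin z) (≤-top {fin x})   = ≤-top
  ∸∞-monoˡ-≤ (fin z) (≤-top {∞})       = ≤-top
  ∸∞-monoˡ-≤ ∞       (fin≤ _)          = ≤∞-refl
  ∸∞-monoˡ-≤ ∞       (≤-top {fin x})   = ≤∞-refl
  ∸∞-monoˡ-≤ ∞       (≤-top {∞})       = ≤∞-refl

  ·∞-monoʳ-≤ : ∀ {c x y} → 0# ≤ c → x ≤∞ y → c ·∞ x ≤∞ c ·∞ y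
  ·∞-monoʳ-≤ 0≤c (fin≤ p)        = fin≤ (*-monoʳ-≤ 0≤c p)
  ·∞-monoʳ-≤ {c} 0≤c (≤-top {x}) with em {c ≡ 0#}
  ·∞-monoʳ-≤ 0≤c (≤-top {fin x}) | yes refl = fin≤ (≤-reflexive (zeroˡ x))
  -- Once `x` is `∞`, the left product unfolds to its own test of `c ≡ 0#`, which the first `with`
  -- did not abstract, so the test is repeated.
  ·∞-monoʳ-≤ {c} 0≤c (≤-top {∞}) | yes c≡0 with em {c ≡ 0#}
  ... | yes _  = ≤∞-refl
  ... | no c≢0 = ⊥-elim (c≢0 c≡0)
  ·∞-monoʳ-≤ 0≤c ≤-top           | no _     = ≤-top

  -- The second summand is a potential value, hence finite. For `x = ∞` and `c = 0` the convention 0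
  -- · ∞ = 0 makes both sides 0.
  ·∞-distribˡ-fin : ∀ c x r → c ·∞ (x +∞ fin r) ≤∞ c ·∞ x +∞ fin (c * r)
  ·∞-distribˡ-fin c (fin x) r = fin≤ (≤-reflexive (distribˡ c x r))
  ·∞-distribˡ-fin c ∞       r with em {c ≡ 0#}
  ... | yes refl = fin≤ (≤-reflexive (sym (trans (cong (0# +_) (zeroˡ r)) (+-identityʳ 0#))))
  ... | no _     = ≤-top

  module _ {b} {I : Set} (f : I → [ b ,∞]) where
    ⨅-lower : ∀ i → val (⨅ f) ≤∞ val (f i)
    ⨅-lower = proj₁ (proj₂ (infimum f))

    ⨅-greatest : (u : [ b ,∞]) → (∀ i → val u ≤∞ val (f i)) → val u ≤∞ val (⨅ f)
    ⨅-greatest = proj₂ (proj₂ (infimum f))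

  module _ {b} {I : Set} (f g : I → [ b ,∞]) (f≤g : ∀ i → val (f i) ≤∞ val (g i)) where
    ⨅-mono : val (⨅ f) ≤∞ val (⨅ g)
    ⨅-mono = ⨅-greatest g (⨅ f) λ i → ≤∞-trans (⨅-lower f i) (f≤g i)

    ⨆-mono : val (⨆ f) ≤∞ val (⨆ g)
    ⨆-mono = ⨆-least f (⨆ g) λ i → ≤∞-trans (f≤g i) (⨆-upper g i)

  when-≤ : ∀ x {P : Set} → P → val (x when P) ≤∞ val x
  when-≤ x {P} p with em {P}
  ... | yes _ = ≤∞-refl
  ... | no ¬p = ⊥-elim (¬p p)

  -- Weighted mixtures and the potential

  mix-mono : ∀ {b b′} w (x y : [ b ,∞]) (x′ y′ : [ b′ ,∞]) →
             val x ≤∞ val x′ → val y ≤∞ val y′ → val (mix w x y) ≤∞ val (mix w x′ y′)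
  mix-mono w _ _ _ _ p q = +∞-mono-≤ (·∞-monoʳ-≤ 0≤c p) (·∞-monoʳ-≤ 0≤d q)
    where open Weights w

  -- Distributing the weights leaves `c * r + d * r`, which is `r` because `c + d ≡ 1#`: a branching
  -- step neither creates nor loses potential.
  mix-add-potential : ∀ π w (X Y : 𝔸 π) σ →
    val (mix w ((X +[ π ]) σ) ((Y +[ π ]) σ)) ≤∞ val (mix w (X σ) (Y σ)) +∞ fin (pot π σ)
  mix-add-potential π w X Y σ = ≤∞-trans
    (+∞-mono-≤ (·∞-distribˡ-fin c (val (X σ)) r) (·∞-distribˡ-fin d (val (Y σ)) r))
    (≤∞-reflexive (trans
      (+∞-interchange-fin (c ·∞ val (X σ)) (d ·∞ val (Y σ)) (c * r) (d * r))
      (cong (λ t → c ·∞ val (X σ) +∞ d ·∞ val (Y σ) +∞ fin t)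
        (trans (sym (distribʳ r c d)) (trans (cong (_* r) c+d≡1) (*-identityˡ r))))))
    where
    open Weights w
    r = pot π σ

  mix-≤-add-potential : ∀ π w (f g : 𝕋) (X Y : 𝔸 π) →
    f ⪯ (X +[ π ]) → g ⪯ (Y +[ π ]) → ∀ σ →
    val (mix w (f σ) (g σ)) ≤∞ val (mix w (X σ) (Y σ)) +∞ fin (pot π σ)
  mix-≤-add-potential π w f g X Y p q σ = ≤∞-trans
    (mix-mono w (f σ) (g σ) ((X +[ π ]) σ) ((Y +[ π ]) σ) (p σ) (q σ))
    (mix-add-potential π w X Y σ)

  -- Monotonicity of `ert`

  ⊕-monoʳ : ∀ f g g′ → g ⪯ g′ → f ⊕ g ⪯ f ⊕ g′
  ⊕-monoʳ f g g′ p (s , h) = ⨅-mono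
    (λ (h₁ , h₂ , _) → f (s , h₁) +⁺ g (s , h₂))
    (λ (h₁ , h₂ , _) → f (s , h₁) +⁺ g′ (s , h₂))
    λ (_ , h₂ , _) → +∞-mono-≤ ≤∞-refl (p (s , h₂))

  -⊖-monoʳ : ∀ f g g′ → g ⪯ g′ → (f -⊖ g) ⪯ (f -⊖ g′)
  -⊖-monoʳ f g g′ p (s , h) = ⨆-mono
    (λ (h′ , _) → g (s , h ⋆ h′) ∸⁺ f (s , h′))
    (λ (h′ , _) → g′ (s , h ⋆ h′) ∸⁺ f (s , h′))
    λ (h′ , _) → ∸∞-monoˡ-≤ (val (f (s , h′))) (p (s , h ⋆ h′))

  -- A prefixed point of `Ψ` is also one of `Φ`, so `lfp Φ` bounds from below the whole family whose
  -- infimum is `lfp Ψ`.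
  lfp-mono : ∀ {b} (Φ Ψ : Above b → Above b) → (∀ g → Φ g ⪯ Ψ g) → lfp Φ ⪯ lfp Ψ
  lfp-mono Φ Ψ Φ⪯Ψ σ = ⨅-greatest _ (lfp Φ σ) λ (g , Ψg⪯g) →
    lfp-least Φ {g} (λ τ → ≤∞-trans (Φ⪯Ψ g τ) (Ψg⪯g τ)) σ

  ert-mono : ∀ C → Monotone (ert C)
  ert-mono (tick e)     {f} {g} p = ⊕-monoʳ (tm e) f g p
  ert-mono (x ≔ e)      {f} {g} p (s , h) = p (s [ x ↦ e s ] , h)
  ert-mono (x ≔alloc e) {f} {g} p σ = ⨆-mono
    (λ v → (cells v -⊖ f [ x / const v ]) σ) (λ v → (cells v -⊖ g [ x / const v ]) σ)
    λ v → -⊖-monoʳ (cells v) (f [ x / const v ]) (g [ x / const v ])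
      (λ (s , h) → p (s [ x ↦ v ] , h)) σ
    where
    cells : ℕ → 𝕋
    cells v = ⨁ e λ i → [ const (v ℕ.+ i ℕ.∸ 1) ↦ const 0 ]ₚ
  ert-mono (⟨ e ⟩≔ e′)  {f} {g} p =
    ⊕-monoʳ [ e ↦-]ₚ ([ e ↦ e′ ]ₚ -⊖ f) ([ e ↦ e′ ]ₚ -⊖ g) (-⊖-monoʳ [ e ↦ e′ ]ₚ f g p)
  ert-mono (x ≔⟨ e ⟩)   {f} {g} p σ = ⨅-mono
    (λ v → (cell v ⊕ after v f) σ) (λ v → (cell v ⊕ after v g) σ)
    λ v → ⊕-monoʳ (cell v) (after v f) (after v g)
      (-⊖-monoʳ (cell v) (f [ x / const v ]) (g [ x / const v ])
        (λ (s , h) → p (s [ x ↦ v ] , h))) σ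
    where
    cell : ℕ → 𝕋
    cell v = [ e ↦ const v ]ₚ
    after : ℕ → 𝕋 → 𝕋
    after v k = cell v -⊖ k [ x / const v ]
  ert-mono (free e)     {f} {g} p = ⊕-monoʳ [ e ↦-]ₚ f g p
  ert-mono (choice C₁ q C₂) {f} {g} p σ@(s , _) = mix-mono (probWeights q s)
    (ert C₁ f σ) (ert C₂ f σ) (ert C₁ g σ) (ert C₂ g σ)
    (ert-mono C₁ {f} {g} p σ) (ert-mono C₂ {f} {g} p σ)
  ert-mono (ite φ C₁ C₂) {f} {g} p σ@(s , _) = mix-mono (guardWeights φ s)
    (ert C₁ f σ) (ert C₂ f σ) (ert C₁ g σ) (ert C₂ g σ)
    (ert-mono C₁ {f} {g} p σ) (ert-mono C₂ {f} {g} p σ)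
  ert-mono (C₁ ⨟ C₂) {f} {g} p =
    ert-mono C₁ {ert C₂ f} {ert C₂ g} (ert-mono C₂ {f} {g} p)
  ert-mono (while φ C) {f} {g} p = lfp-mono
    (λ k → mixGuard φ (ert C k) f) (λ k → mixGuard φ (ert C k) g)
    -- Both loop functionals are compared at the same `k`, so the body branches agree and only the
    -- exit values `f` and `g` differ.
    λ k σ@(s , _) → mix-mono (guardWeights φ s)
      (ert C k σ) (f σ) (ert C k σ) (g σ) ≤∞-refl (p σ)

  -- Comparing `ert` with `aert`

  tm-⊕-≤ : ∀ e f s h → val ((tm e ⊕ f) (s , h)) ≤∞ fin (fromℕ (e s)) +∞ val (f (s , h))
  tm-⊕-≤ e f s h = ≤∞-trans
    -- The final `refl` proves `h ≡ h∅ ⋆ h`: the left-biased union with the empty heap reduces to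
    -- `lookup h`, and the side conditions are irrelevant.
    (⨅-lower _ (h∅ , h , (λ _ → inj₁ refl) , refl))
    (+∞-mono-≤ (when-≤ (fromℕ∞ (e s)) refl) ≤∞-refl)

  ⪯-sub-add : ∀ π (f : 𝕋) → f ⪯ ((f -[ π ]) +[ π ])
  ⪯-sub-add π f σ = ≤∞-sub-add (val (f σ)) (pot π σ)

  -- `lfp Ψ` is an infimum in `𝔸 π`, so π is first moved to the left: `lfp Φ -[ π ]` lies in `𝔸 π`
  -- and is below each prefixed point `Y` of `Ψ`, as `Y +[ π ]` is prefixed for `Φ`.
  lfp-≤-add-potential : ∀ π (Φ : 𝕋 → 𝕋) (Ψ : 𝔸 π → 𝔸 π) →
    (∀ Y → Φ (Y +[ π ]) ⪯ (Ψ Y +[ π ])) → lfp Φ ⪯ (lfp Ψ +[ π ])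
  lfp-≤-add-potential π Φ Ψ Φ⪯Ψ σ = ≤∞-trans
    (⪯-sub-add π (lfp Φ) σ)
    (+∞-mono-≤ (⨅-greatest _ ((lfp Φ -[ π ]) σ) below) ≤∞-refl)
    where
    below : ∀ i → val ((lfp Φ -[ π ]) σ) ≤∞ val (proj₁ i σ)
    below (Y , ΨY⪯Y) = ≤∞-add⇒sub-≤∞ (lfp-least Φ {Y +[ π ]}
      (λ τ → ≤∞-trans (Φ⪯Ψ Y τ) (+∞-mono-≤ (ΨY⪯Y τ) ≤∞-refl)) σ)

  -- The general `X` carries the induction: sequencing uses `aert π C₂ X` as postruntime, and loops
  -- use the bound for the body at every `Y`.
  ert-≤-aert : ∀ π C (X : 𝔸 π) → ert C (X +[ π ]) ⪯ (aert π C X +[ π ])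
  ert-≤-aert π (tick e) X σ@(s , h) = ≤∞-trans
    (tm-⊕-≤ e (X +[ π ]) s h)
    (≤∞-reflexive (sym (+∞-assoc (fin (fromℕ (e s))) (val (X σ)) (fin (pot π σ)))))
  ert-≤-aert π C@(x ≔ e)      X = ⪯-sub-add π (ert C (X +[ π ]))
  ert-≤-aert π C@(x ≔alloc e) X = ⪯-sub-add π (ert C (X +[ π ]))
  ert-≤-aert π C@(⟨ e ⟩≔ e′)  X = ⪯-sub-add π (ert C (X +[ π ]))
  ert-≤-aert π C@(x ≔⟨ e ⟩)   X = ⪯-sub-add π (ert C (X +[ π ]))
  ert-≤-aert π C@(free e)     X = ⪯-sub-add π (ert C (X +[ π ]))
  ert-≤-aert π (choice C₁ p C₂) X σ@(s , _) = mix-≤-add-potential π (probWeights p s)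
    (ert C₁ (X +[ π ])) (ert C₂ (X +[ π ])) (aert π C₁ X) (aert π C₂ X)
    (ert-≤-aert π C₁ X) (ert-≤-aert π C₂ X) σ
  ert-≤-aert π (ite φ C₁ C₂) X σ@(s , _) = mix-≤-add-potential π (guardWeights φ s)
    (ert C₁ (X +[ π ])) (ert C₂ (X +[ π ])) (aert π C₁ X) (aert π C₂ X)
    (ert-≤-aert π C₁ X) (ert-≤-aert π C₂ X) σ
  ert-≤-aert π (C₁ ⨟ C₂) X σ = ≤∞-trans
    -- Monotonicity pushes the bound for `C₂` through `ert C₁`, which brings the postruntime into
    -- the form `_ +[ π ]` that the hypothesis for `C₁` expects.
    (ert-mono C₁ {ert C₂ (X +[ π ])} {aert π C₂ X +[ π ]} (ert-≤-aert π C₂ X) σ)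
    (ert-≤-aert π C₁ (aert π C₂ X) σ)
  ert-≤-aert π (while φ C) X = lfp-≤-add-potential π
    (λ g → mixGuard φ (ert C g) (X +[ π ])) (λ Y → mixGuard φ (aert π C Y) X)
    λ Y σ@(s , _) → mix-≤-add-potential π (guardWeights φ s)
      (ert C (Y +[ π ])) (X +[ π ]) (aert π C Y) X
      (ert-≤-aert π C Y) (λ _ → ≤∞-refl) σ

mainTheorem2 : (em : ExcludedMiddle 0ℓ) (R : RealNumbers) (n : ℕ) → let open Semantics em R n in
    (π : Potential) (C : Program n) → ert C 𝟎 ⪯ (aert π C (𝟎ᴬ π) +[ π ])
mainTheorem2 em R n π C σ = ≤∞-trans
  -- Elements of `𝕋` carry their own nonnegativity proof, which gives 0 ⪯ 0 + π.
  (ert-mono em R n C {𝟎} {𝟎ᴬ π +[ π ]} (λ τ → b≤val ((𝟎ᴬ π +[ π ]) τ)) σ)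
  (ert-≤-aert em R n π C (𝟎ᴬ π) σ)
  where open Semantics em R n
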